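{- Let $k\ge1$. The set of $k$-codes is in bijection with the set of affine permutations in $\tilde S_{k+1}$.
   Context: Fix a positive integer $k$ and let $I=\mathbb Z/(k+1)\mathbb Z$. A $k$-code is a function $\alpha:I\to\mathbb Z_{\ge0}$ such that $\alpha(i)=0$ for at least one $i\in I$. The affine symmetric group $\tilde S_{k+1}$ is the affine Weyl group of type $A_k^{(1)}$; its elements, the affine permutations, are the bijections $x:\mathbb Z\to\mathbb Z$ such that $x(i+k+1)=x(i)+k+1$ for all $i$ and $\sum_{i=1}^{k+1}x(i)=\binom{k+2}{2}$. -}

module Defs where

open import Algebra.Properties.CommutativeMonoid.Sum using (sum)
open import Data.Fin.Base using (Fin; toℕ)
open import Data.Integer.Base using (ℤ; +_; _+_)
open import Data.Integer.Properties using (+-0-commutativeMonoid)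
open import Data.Nat.Base as ℕ using (ℕ; suc)
open import Data.Nat.Combinatorics using (_C_)
open import Data.Product.Base using (∃)
open import Function.Definitions using (Bijective)
open import Level using (0ℓ)
open import Relation.Binary.Bundles using (Setoid)
import Relation.Binary.Construct.On as On
open import Relation.Binary.PropositionalEquality using (_≡_; _→-setoid_)

-- The index set ℤ/(k+1)ℤ is represented by its residues Fin (suc k).
record KCode (k : ℕ) : Set where
  field
    code    : Fin (suc k) → ℕ
    hasZero : ∃ λ i → code i ≡ 0

record AffinePermutation (k : ℕ) : Set where
  field
    perm      : ℤ → ℤ
    bijective : Bijective _≡_ _≡_ perm
    periodic  : ∀ i → perm (i + + suc k) ≡ perm i + + suc k
    -- toℕ i ranges over 0, …, k, so the arguments of perm are 1, …, k + 1.
    windowSum : sum +-0-commutativeMonoid {suc k} (λ i → perm (+ suc (toℕ i)))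
                ≡ + ((k ℕ.+ 2) C 2)

-- Elements of both setoids are compared as functions: the proof components,
-- including the choice of a zero of a code, are ignored.
KCodes : ℕ → Setoid 0ℓ 0ℓ
KCodes k = On.setoid (Fin (suc k) →-setoid ℕ) (KCode.code {k})

AffinePermutations : ℕ → Setoid 0ℓ 0ℓ
AffinePermutations k = On.setoid (ℤ →-setoid ℤ) (AffinePermutation.perm {k})

{-# OPTIONS --safe #-}

-- A code is determined by its class modulo the constant functions, that is, by
-- the k integers α(i) − α(0). An affine permutation is determined by the
-- quotients and residues of x(1), …, x(k + 1) modulo k + 1: the residues form a
-- permutation of Fin (suc k), and the window condition says that the quotients
-- sum to 0, so that k of them are free. Since ℤ ≅ ℤ × Fin m, the permutation can
-- be absorbed: its Lehmer code is a tuple in Fin (k + 1) × … × Fin 2, one factor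
-- for each of the k integers.
module Submission where

open import Defs
open import Algebra.Bundles using (AbelianGroup)
import Algebra.Properties.CommutativeMonoid.Sum as Sum
import Algebra.Properties.Group as Group
import Algebra.Properties.Semiring.Sum as SemiringSum
open import Data.Fin.Base using (Fin; zero; suc; toℕ; fromℕ; fromℕ<; inject₁; punchIn)
open import Data.Fin.Permutation as Perm using (Permutation; _⟨$⟩ʳ_; _⟨$⟩ˡ_)
open import Data.Fin.Properties
  using (toℕ-injective; toℕ<n; toℕ-fromℕ; toℕ-fromℕ<; toℕ-inject₁; punchIn-injective; _≟_)
open import Data.Integer.Base renaming (suc to sucℤ)
open import Data.Integer.DivMod using (n%ℕd<d; a≡a%ℕn+[a/ℕn]*n)
open import Data.Integer.Properties hiding (_≟_)
open import Data.Integer.Tactic.RingSolver using (solve-∀)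
open import Data.Nat.Base as ℕ using (ℕ; zero; suc)
import Data.Nat.Properties as ℕ
open import Data.Nat.Combinatorics using (_C_; nCk+nC[k+1]≡[n+1]C[k+1]; nC1≡n)
open import Data.Product.Base using (_×_; _,_; ∃; proj₁; proj₂)
open import Data.Product.Relation.Binary.Pointwise.NonDependent using (_×ₛ_)
open import Data.Sum.Base using (inj₁; inj₂)
open import Data.Vec.Functional using (Vector; _∷_; tail)
open import Function.Base using (_∘_)
open import Function.Bundles using (Bijection; mk⤖)
open import Function.Consequences.Propositional using (strictlySurjective⇒surjective)
import Function.Construct.Composition as Compose
open import Function.Definitions using (Bijective)
open import Function.Properties.Bijection using (⤖⇒↔)
open import Level using (0ℓ)
open import Relation.Binary.Bundles using (Setoid)
import Relation.Binary.Construct.On as On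
open import Relation.Binary.Definitions using (tri<; tri≈; tri>)
open import Relation.Binary.PropositionalEquality
open import Relation.Nullary.Decidable.Core using (yes; no)
open import Relation.Nullary.Negation using (contradiction)

open Group (AbelianGroup.group +-0-abelianGroup) using ()
  renaming (∙-cancelˡ to +-cancelˡ; ∙-cancelʳ to +-cancelʳ)
open Sum +-0-commutativeMonoid using (sum; sum-cong-≗; sum-init-last; sum-permute; ∑-distrib-+)
open SemiringSum +-*-semiring using (*-distribʳ-sum)

private
  variable
    k : ℕ

-- Division with remainder, with remainders 1, …, k + 1

-- With remainders starting at 1, `value 0ℤ` lists exactly the window `1, …, k + 1`.
value : ℤ → Fin (suc k) → ℤ
value {k} q r = q * + suc k + + suc (toℕ r)

-- A remainder is at most `k + 1`, so block `p` ends no later than `(p + 1)(k + 1)`; a remainder is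
-- at least 1, so block `q` lies strictly above `q (k + 1)`.
value-mono-< : ∀ {p q} (r s : Fin (suc k)) → p < q → value p r < value q s
value-mono-< {k} {p} {q} r s p<q = begin-strict
  p * + suc k + + suc (toℕ r)   ≤⟨ +-monoʳ-≤ (p * + suc k) (+≤+ (toℕ<n r)) ⟩
  p * + suc k + + suc k         ≡⟨ +-comm (p * + suc k) (+ suc k) ⟩
  + suc k + p * + suc k         ≡⟨ suc-* p (+ suc k) ⟨
  sucℤ p * + suc k              ≤⟨ *-monoʳ-≤-nonNeg (+ suc k) (i<j⇒suc[i]≤j p<q) ⟩
  q * + suc k                   ≡⟨ +-identityʳ (q * + suc k) ⟨
  q * + suc k + 0ℤ              <⟨ +-monoʳ-< (q * + suc k) (+<+ ℕ.z<s) ⟩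
  q * + suc k + + suc (toℕ s)   ∎
  where open ≤-Reasoning

value-injective : ∀ p q {r s : Fin (suc k)} → value p r ≡ value q s → p ≡ q × r ≡ s
value-injective {k} p q {r} {s} eq with <-cmp p q
... | tri< p<q _ _ = contradiction eq (<⇒≢ (value-mono-< r s p<q))
... | tri> _ _ q<p = contradiction (sym eq) (<⇒≢ (value-mono-< s r q<p))
... | tri≈ _ refl _ = refl ,
  toℕ-injective (ℕ.suc-injective (+-injective (+-cancelˡ (p * + suc k) _ _ eq)))

-- Subtracting 1 first matches the remainders `0, …, k` of `_/ℕ_` with `1, …, k + 1`.
quotient : (k : ℕ) → ℤ → ℤ
quotient k z = (z - 1ℤ) /ℕ suc k

residue : (k : ℕ) → ℤ → Fin (suc k)
residue k z = fromℕ< (n%ℕd<d (z - 1ℤ) (suc k))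

value-quotient-residue : ∀ z → value (quotient k z) (residue k z) ≡ z
value-quotient-residue {k} z = begin
  q * + suc k + + suc (toℕ (residue k z))
    ≡⟨ cong (λ r → q * + suc k + + suc r) (toℕ-fromℕ< (n%ℕd<d (z - 1ℤ) (suc k))) ⟩
  q * + suc k + (1ℤ + r)                   ≡⟨ reorder (q * + suc k) r ⟩
  (r + q * + suc k) + 1ℤ                   ≡⟨ cong (_+ 1ℤ) (a≡a%ℕn+[a/ℕn]*n (z - 1ℤ) (suc k)) ⟨
  (z - 1ℤ) + 1ℤ                            ≡⟨ cancel z ⟩
  z                                        ∎
  where
  open ≡-Reasoning
  q = quotient k z
  r = + ((z - 1ℤ) %ℕ suc k)
  reorder : ∀ a b → a + (1ℤ + b) ≡ (b + a) + 1ℤ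
  reorder = solve-∀
  cancel : ∀ a → (a - 1ℤ) + 1ℤ ≡ a
  cancel = solve-∀

-- Dividing `value q r` and rebuilding it gives two representations of one integer, which must
-- coincide.
quotient-value : ∀ q (r : Fin (suc k)) → quotient k (value q r) ≡ q
quotient-value q r =
  proj₁ (value-injective (quotient _ (value q r)) q (value-quotient-residue (value q r)))

residue-value : ∀ q (r : Fin (suc k)) → residue k (value q r) ≡ r
residue-value q r =
  proj₂ (value-injective (quotient _ (value q r)) q (value-quotient-residue (value q r)))

value-shift : ∀ p q (r : Fin (suc k)) → value (p + q) r ≡ value q r + p * + suc k
value-shift {k} p q r = shift p q (+ suc k) (+ suc (toℕ r))
  where
  shift : ∀ p q n r → (p + q) * n + r ≡ q * n + r + p * n
  shift = solve-∀

-- Codes modulo constant functions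

minimum : (f : Vector ℤ (suc k)) → ∃ λ i → ∀ j → f i ≤ f j
minimum {zero}  f = zero , λ { zero → ≤-refl }
minimum {suc k} f with i , fi≤ ← minimum (tail f) | ≤-total (f zero) (f (suc i))
... | inj₁ f0≤fi = zero  , λ { zero → ≤-refl ; (suc j) → ≤-trans f0≤fi (fi≤ j) }
... | inj₂ fi≤f0 = suc i , λ { zero → fi≤f0  ; (suc j) → fi≤ j }

differences : KCode k → Vector ℤ k
differences α i = + KCode.code α (suc i) - + KCode.code α zero

code≡difference+base : (α : KCode k) → ∀ i →
                       + KCode.code α i ≡ (0ℤ ∷ differences α) i + + KCode.code α zero
code≡difference+base α zero    = sym (+-identityˡ (+ KCode.code α zero))
code≡difference+base α (suc i) = cancel (+ KCode.code α (suc i)) (+ KCode.code α zero)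
  where
  cancel : ∀ a b → a ≡ (a - b) + b
  cancel = solve-∀

private
  ∷-cong : {d e : Vector ℤ k} → d ≗ e → (0ℤ ∷ d) ≗ (0ℤ ∷ e)
  ∷-cong d≗e zero    = refl
  ∷-cong d≗e (suc i) = d≗e i

-- At a zero i of α, the value β(i) ≥ 0 is the difference of the values at 0.
base-≤ : (α β : KCode k) → differences α ≗ differences β →
         KCode.code α zero ℕ.≤ KCode.code β zero
base-≤ α β eq with i , αi≡0 ← KCode.hasZero α = drop‿+≤+ (begin
  a                  ≡⟨ +-identityˡ a ⟨
  0ℤ + a             ≤⟨ +-monoˡ-≤ a (+≤+ ℕ.z≤n) ⟩
  + β.code i + a     ≡⟨ cong (_+ a) (code≡difference+base β i) ⟩
  d β + b + a        ≡⟨ cong (λ d → d + b + a) (∷-cong eq i) ⟨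
  d α + b + a        ≡⟨ swap (d α) b a ⟩
  d α + a + b        ≡⟨ cong (_+ b) (code≡difference+base α i) ⟨
  + α.code i + b     ≡⟨ cong (λ x → + x + b) αi≡0 ⟩
  0ℤ + b             ≡⟨ +-identityˡ b ⟩
  b                  ∎)
  where
  open ≤-Reasoning
  module α = KCode α
  module β = KCode β
  a = + α.code zero
  b = + β.code zero
  d : KCode _ → ℤ
  d γ = (0ℤ ∷ differences γ) i
  swap : ∀ x y z → x + y + z ≡ x + z + y
  swap = solve-∀

-- The inequality `base-≤` in both directions gives equal values at `zero`, and these together with
-- the differences determine a code.
differences-injective : (α β : KCode k) → differences α ≗ differences β →
                        KCode.code α ≗ KCode.code β
differences-injective α β eq i = +-injective (begin
  + KCode.code α i                                  ≡⟨ code≡difference+base α i ⟩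
  (0ℤ ∷ differences α) i + + KCode.code α zero      ≡⟨ cong₂ _+_ (∷-cong eq i) (cong +_ base≡) ⟩
  (0ℤ ∷ differences β) i + + KCode.code β zero      ≡⟨ code≡difference+base β i ⟨
  + KCode.code β i                                  ∎)
  where
  open ≡-Reasoning
  base≡ = ℕ.≤-antisym (base-≤ α β eq) (base-≤ β α (sym ∘ eq))

-- Among the translates of `0ℤ ∷ d`, this is the one with minimum 0. The minimality of entry `i`
-- makes the argument of `∣_∣` nonnegative, so the absolute value only changes the type.
fromDifferences : Vector ℤ k → KCode k
fromDifferences d with i , _ ← minimum (0ℤ ∷ d) = record
  { code    = λ j → ∣ (0ℤ ∷ d) j - (0ℤ ∷ d) i ∣
  ; hasZero = i , cong ∣_∣ (+-inverseʳ ((0ℤ ∷ d) i))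
  }

differences-fromDifferences : (d : Vector ℤ k) → differences (fromDifferences d) ≗ d
differences-fromDifferences d j with i , min ← minimum (0ℤ ∷ d) = begin
  + ∣ d j - m ∣ - + ∣ 0ℤ - m ∣
    ≡⟨ cong₂ _-_ (0≤i⇒+∣i∣≡i (i≤j⇒0≤j-i (min (suc j)))) (0≤i⇒+∣i∣≡i (i≤j⇒0≤j-i (min zero))) ⟩
  (d j - m) - (0ℤ - m)           ≡⟨ cancel (d j) m ⟩
  d j                            ∎
  where
  open ≡-Reasoning
  m = (0ℤ ∷ d) i
  cancel : ∀ a b → (a - b) - (0ℤ - b) ≡ a
  cancel = solve-∀

codes⤖differences : ∀ k → Bijection (KCodes k) (Fin k →-setoid ℤ)
codes⤖differences k = record
  { to        = differences
  ; cong      = λ α≗β i → cong₂ (λ a b → + a - + b) (α≗β (suc i)) (α≗β zero)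
  ; bijective = (λ {α} {β} → differences-injective α β)
              , λ d → fromDifferences d , λ γ≗ i →
                  trans (cong₂ (λ a b → + a - + b) (γ≗ (suc i)) (γ≗ zero))
                        (differences-fromDifferences d i)
  }

-- Absorbing a permutation into a vector of integers

Permutations : ℕ → Setoid 0ℓ 0ℓ
Permutations n = On.setoid (Fin n →-setoid Fin n) (_⟨$⟩ʳ_ {n} {n})

-- The divisor drops along the vector: a vector of length `k` is divided entrywise by
-- `k + 1, k, …, 2`.
quotients : Vector ℤ k → Vector ℤ k
quotients {suc k} v zero    = quotient (suc k) (v zero)
quotients {suc k} v (suc i) = quotients (tail v) i

-- The residues are read as a Lehmer code: the first is the image of `zero`, and the others encode
-- the permutation left after removing `zero` and its image.
unrank : Vector ℤ k → Permutation (suc k) (suc k)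
unrank {zero}  v = Perm.id
unrank {suc k} v = Perm.insert zero (residue (suc k) (v zero)) (unrank (tail v))

-- Joint inverse of `quotients` and `unrank`: each entry combines a prescribed quotient with the
-- next Lehmer digit of `σ`.
rank : Vector ℤ k → Permutation (suc k) (suc k) → Vector ℤ k
rank {suc k} c σ zero    = value (c zero) (σ ⟨$⟩ʳ zero)
rank {suc k} c σ (suc i) = rank (tail c) (Perm.remove zero σ) i

insert-cong : ∀ {n} (i : Fin (suc n)) {j j′} (π ρ : Permutation n n) → j ≡ j′ → π Perm.≈ ρ →
              Perm.insert i j π Perm.≈ Perm.insert i j′ ρ
insert-cong i π ρ refl π≈ρ l with i ≟ l
... | yes _ = refl
... | no  _ = cong (punchIn _) (π≈ρ _)

insert-injective : ∀ {n} (j j′ : Fin (suc n)) (π ρ : Permutation n n) →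
                   Perm.insert zero j π Perm.≈ Perm.insert zero j′ ρ → j ≡ j′ × π Perm.≈ ρ
-- At `zero` the two insertions evaluate to `j` and `j′`. Once these agree, both sides skip the same
-- value and `punchIn j` can be cancelled.
insert-injective j j′ π ρ eq with refl ← eq zero = refl , λ l →
  punchIn-injective j _ _ (begin
    punchIn j (π ⟨$⟩ʳ l)                 ≡⟨ Perm.insert-punchIn zero j π l ⟨
    Perm.insert zero j π ⟨$⟩ʳ suc l      ≡⟨ eq (suc l) ⟩
    Perm.insert zero j ρ ⟨$⟩ʳ suc l      ≡⟨ Perm.insert-punchIn zero j ρ l ⟩
    punchIn j (ρ ⟨$⟩ʳ l)                 ∎)
  where open ≡-Reasoning

quotients-cong : {v w : Vector ℤ k} → v ≗ w → quotients v ≗ quotients w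
quotients-cong v≗w zero    = cong (quotient _) (v≗w zero)
quotients-cong v≗w (suc i) = quotients-cong (v≗w ∘ suc) i

unrank-cong : {v w : Vector ℤ k} → v ≗ w → unrank v Perm.≈ unrank w
unrank-cong {zero}  v≗w i = refl
unrank-cong {suc k} {v} {w} v≗w =
  insert-cong zero (unrank (tail v)) (unrank (tail w))
    (cong (residue _) (v≗w zero)) (unrank-cong (v≗w ∘ suc))

quotients-unrank-injective : (v w : Vector ℤ k) → quotients v ≗ quotients w →
                             unrank v Perm.≈ unrank w → v ≗ w
quotients-unrank-injective {suc k} v w q≗ u≈
  with r≡ , t≈ ← insert-injective _ _ (unrank (tail v)) (unrank (tail w)) u≈ = λ
  { zero    → trans (sym (value-quotient-residue (v zero)))
                    (trans (cong₂ value (q≗ zero) r≡) (value-quotient-residue (w zero)))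
  ; (suc i) → quotients-unrank-injective (tail v) (tail w) (q≗ ∘ suc) t≈ i
  }

quotients-rank : (c : Vector ℤ k) (σ : Permutation (suc k) (suc k)) → quotients (rank c σ) ≗ c
quotients-rank c σ zero    = quotient-value (c zero) (σ ⟨$⟩ʳ zero)
quotients-rank c σ (suc i) = quotients-rank (tail c) (Perm.remove zero σ) i

unrank-rank : (c : Vector ℤ k) (σ : Permutation (suc k) (suc k)) → unrank (rank c σ) Perm.≈ σ
-- `Fin 1` has a single element, so `σ` agrees with the identity.
unrank-rank {zero}  c σ zero with zero ← σ ⟨$⟩ʳ zero = refl
unrank-rank {suc k} c σ i = trans
  (insert-cong zero (unrank (tail (rank c σ))) (Perm.remove zero σ)
    (residue-value (c zero) (σ ⟨$⟩ʳ zero)) (unrank-rank (tail c) (Perm.remove zero σ)) i)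
  (Perm.insert-remove zero σ i)

vectors⤖vectors×permutations : ∀ k →
  Bijection (Fin k →-setoid ℤ) ((Fin k →-setoid ℤ) ×ₛ Permutations (suc k))
vectors⤖vectors×permutations k = record
  { to        = λ v → quotients v , unrank v
  ; cong      = λ v≗w → quotients-cong v≗w , unrank-cong v≗w
  ; bijective = (λ {v} {w} (q≗ , u≈) → quotients-unrank-injective v w q≗ u≈)
              , λ (c , σ) → rank c σ , λ v≗ →
                  (λ i → trans (quotients-cong v≗ i) (quotients-rank c σ i)) ,
                  (λ i → trans (unrank-cong v≗ i) (unrank-rank c σ i))
  }

-- Affine permutations from quotients and residues

-- On residue class `r` the block number moves by `c r` and the residue becomes `σ ⟨$⟩ʳ r`. The
-- pairs `(c , σ)` with arbitrary `c` give the extended affine symmetric group; the window condition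
-- singles out `sum c ≡ 0ℤ`.
affine : Vector ℤ (suc k) → Permutation (suc k) (suc k) → ℤ → ℤ
affine {k} c σ z = value (quotient k z + c (residue k z)) (σ ⟨$⟩ʳ residue k z)

affine-value : (c : Vector ℤ (suc k)) (σ : Permutation (suc k) (suc k)) → ∀ q r →
               affine c σ (value q r) ≡ value (q + c r) (σ ⟨$⟩ʳ r)
affine-value c σ q r =
  cong₂ (λ p s → value (p + c s) (σ ⟨$⟩ʳ s)) (quotient-value q r) (residue-value q r)

≗-on-values : {f g : ℤ → ℤ} → (∀ q (r : Fin (suc k)) → f (value q r) ≡ g (value q r)) → f ≗ g
≗-on-values {f = f} {g} eq z =
  subst (λ z → f z ≡ g z) (value-quotient-residue z) (eq (quotient _ z) (residue _ z))

affine-bijective : (c : Vector ℤ (suc k)) (σ : Permutation (suc k) (suc k)) →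
                   Bijective _≡_ _≡_ (affine c σ)
affine-bijective {k} c σ = injective , strictlySurjective⇒surjective surjective
  where
  open ≡-Reasoning
  injective : ∀ {y z} → affine c σ y ≡ affine c σ z → y ≡ z
  injective {y} {z} eq
    with p≡ , s≡ ← value-injective (quotient k y + c (residue k y)) (quotient k z + c (residue k z)) eq
    = begin
    y                                    ≡⟨ value-quotient-residue y ⟨
    value (quotient k y) (residue k y)   ≡⟨ cong₂ value q≡ r≡ ⟩
    value (quotient k z) (residue k z)   ≡⟨ value-quotient-residue z ⟩
    z                                    ∎
    where
    r≡ : residue k y ≡ residue k z
    r≡ = trans (sym (Perm.inverseˡ σ)) (trans (cong (σ ⟨$⟩ˡ_) s≡) (Perm.inverseˡ σ))
    q≡ : quotient k y ≡ quotient k z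
    q≡ = +-cancelʳ (c (residue k y)) _ _ (trans p≡ (cong (λ r → quotient k z + c r) (sym r≡)))
  surjective : ∀ y → ∃ λ z → affine c σ z ≡ y
  -- The preimage has the residue that `σ` sends to that of `y`, and its quotient compensates in
  -- advance for the shift `c r`.
  surjective y = value (q - c r) r , (begin
    affine c σ (value (q - c r) r)       ≡⟨ affine-value c σ (q - c r) r ⟩
    value (q - c r + c r) (σ ⟨$⟩ʳ r)     ≡⟨ cong₂ value (cancel q (c r)) (Perm.inverseʳ σ) ⟩
    value q (residue k y)                ≡⟨ value-quotient-residue y ⟩
    y                                    ∎)
    where
    q = quotient k y
    r = σ ⟨$⟩ˡ residue k y
    cancel : ∀ a b → a - b + b ≡ a
    cancel = solve-∀

-- Adding `k + 1` raises the quotient by 1 and keeps the residue, on which alone the shift and the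
-- new residue depend.
affine-periodic : (c : Vector ℤ (suc k)) (σ : Permutation (suc k) (suc k)) → ∀ z →
                  affine c σ (z + + suc k) ≡ affine c σ z + + suc k
affine-periodic {k} c σ = ≗-on-values λ q r → begin
  affine c σ (value q r + + suc k)           ≡⟨ cong (affine c σ) (shift q r) ⟨
  affine c σ (value (1ℤ + q) r)              ≡⟨ affine-value c σ (1ℤ + q) r ⟩
  value (1ℤ + q + c r) (σ ⟨$⟩ʳ r)
    ≡⟨ cong (λ p → value p (σ ⟨$⟩ʳ r)) (+-assoc 1ℤ q (c r)) ⟩
  value (1ℤ + (q + c r)) (σ ⟨$⟩ʳ r)          ≡⟨ shift (q + c r) (σ ⟨$⟩ʳ r) ⟩
  value (q + c r) (σ ⟨$⟩ʳ r) + + suc k       ≡⟨ cong (_+ + suc k) (affine-value c σ q r) ⟨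
  affine c σ (value q r) + + suc k           ∎
  where
  open ≡-Reasoning
  shift : ∀ q (r : Fin (suc k)) → value (1ℤ + q) r ≡ value q r + + suc k
  shift q r = trans (value-shift 1ℤ q r) (cong (λ n → value q r + n) (*-identityˡ (+ suc k)))

-- The window sum and shift vectors of sum zero

sum-1…n : ∀ n → sum {n} (λ i → + suc (toℕ i)) ≡ + (suc n C 2)
sum-1…n zero    = refl
sum-1…n (suc n) = begin
  sum {suc n} (λ i → + suc (toℕ i))
    ≡⟨ sum-init-last {n} (λ i → + suc (toℕ i)) ⟩
  sum {n} (λ i → + suc (toℕ (inject₁ i))) + + suc (toℕ (fromℕ n))
    ≡⟨ cong₂ _+_ (sum-cong-≗ {n} (λ i → cong (+_ ∘ suc) (toℕ-inject₁ i)))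
                 (cong (+_ ∘ suc) (toℕ-fromℕ n)) ⟩
  sum {n} (λ i → + suc (toℕ i)) + + suc n
    ≡⟨ cong (_+ + suc n) (sum-1…n n) ⟩
  + (suc n C 2 ℕ.+ suc n)
    -- Writing the last term `suc n` as `suc n C 1` prepares for Pascal's rule.
    ≡⟨ cong (λ m → + (suc n C 2 ℕ.+ m)) (nC1≡n (suc n)) ⟨
  + (suc n C 2 ℕ.+ suc n C 1)
    ≡⟨ cong +_ (ℕ.+-comm (suc n C 2) (suc n C 1)) ⟩
  + (suc n C 1 ℕ.+ suc n C 2)
    ≡⟨ cong +_ (nCk+nC[k+1]≡[n+1]C[k+1] (suc n) 1) ⟩
  + (suc (suc n) C 2)                                                 ∎
  where open ≡-Reasoning

-- The remainders are `1, …, k + 1` in the order given by `σ`, so their sum is independent of `σ`.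
sum-values : (c : Vector ℤ (suc k)) (σ : Permutation (suc k) (suc k)) →
             sum (λ i → value (c i) (σ ⟨$⟩ʳ i)) ≡ sum c * + suc k + + ((k ℕ.+ 2) C 2)
sum-values {k} c σ = begin
  sum (λ i → value (c i) (σ ⟨$⟩ʳ i))
    ≡⟨ ∑-distrib-+ (λ i → c i * + suc k) (λ i → + suc (toℕ (σ ⟨$⟩ʳ i))) ⟩
  sum (λ i → c i * + suc k) + sum (λ i → + suc (toℕ (σ ⟨$⟩ʳ i)))
    ≡⟨ cong₂ _+_ (*-distribʳ-sum (+ suc k) c) (sum-permute (λ i → + suc (toℕ i)) σ) ⟨
  sum c * + suc k + sum {suc k} (λ i → + suc (toℕ i))
    ≡⟨ cong (λ t → sum c * + suc k + t) (sum-1…n (suc k)) ⟩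
  sum c * + suc k + + ((2 ℕ.+ k) C 2)
    ≡⟨ cong (λ m → sum c * + suc k + + (m C 2)) (ℕ.+-comm 2 k) ⟩
  sum c * + suc k + + ((k ℕ.+ 2) C 2)                                            ∎
  where open ≡-Reasoning

-- Parametrises the integer vectors with sum 0 by their entries after the first.
prependNegatedSum : Vector ℤ k → Vector ℤ (suc k)
prependNegatedSum c = - sum c ∷ c

prependNegatedSum-cong : {c d : Vector ℤ k} → c ≗ d → prependNegatedSum c ≗ prependNegatedSum d
prependNegatedSum-cong c≗d zero    = cong -_ (sum-cong-≗ c≗d)
prependNegatedSum-cong c≗d (suc i) = c≗d i

prependNegatedSum-tail : (c : Vector ℤ (suc k)) → sum c ≡ 0ℤ → prependNegatedSum (tail c) ≗ c
prependNegatedSum-tail c Σc≡0 (suc i) = refl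
prependNegatedSum-tail c Σc≡0 zero    = begin
  - sum (tail c)                                    ≡⟨ cancel (c zero) (sum (tail c)) ⟩
  c zero - sum c                                    ≡⟨ cong (λ s → c zero - s) Σc≡0 ⟩
  c zero - 0ℤ                                       ≡⟨ +-identityʳ (c zero) ⟩
  c zero                                            ∎
  where
  open ≡-Reasoning
  cancel : ∀ a b → - b ≡ a - (a + b)
  cancel = solve-∀

toAffine : Vector ℤ k → Permutation (suc k) (suc k) → AffinePermutation k
toAffine {k} c σ = record
  { perm      = affine c⁺ σ
  ; bijective = affine-bijective c⁺ σ
  ; periodic  = affine-periodic c⁺ σ
  ; windowSum = begin
      -- The window argument `+ suc (toℕ i)` is `value 0ℤ i` by computation.
      sum {suc k} (λ i → affine c⁺ σ (value 0ℤ i))    ≡⟨ sum-cong-≗ {suc k} (affine-value c⁺ σ 0ℤ) ⟩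
      sum {suc k} (λ i → value (0ℤ + c⁺ i) (σ ⟨$⟩ʳ i))
        ≡⟨ sum-cong-≗ {suc k} (λ i → cong (λ q → value q (σ ⟨$⟩ʳ i)) (+-identityˡ (c⁺ i))) ⟩
      sum {suc k} (λ i → value (c⁺ i) (σ ⟨$⟩ʳ i))     ≡⟨ sum-values c⁺ σ ⟩
      sum c⁺ * + suc k + + ((k ℕ.+ 2) C 2)
        ≡⟨ cong (λ s → s * + suc k + + ((k ℕ.+ 2) C 2)) (+-inverseˡ (sum c)) ⟩
      + ((k ℕ.+ 2) C 2)                                ∎
  }
  where
  open ≡-Reasoning
  c⁺ = prependNegatedSum c

affine-cong : (c d : Vector ℤ (suc k)) (σ τ : Permutation (suc k) (suc k)) →
              c ≗ d → σ Perm.≈ τ → affine c σ ≗ affine d τ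
affine-cong {k} c d σ τ c≗d σ≈τ z =
  cong₂ (λ x s → value (quotient k z + x) s) (c≗d (residue k z)) (σ≈τ (residue k z))

-- Evaluation on the window suffices: the image of `value 0ℤ i` has quotient `0ℤ + c i` and residue
-- `σ ⟨$⟩ʳ i`.
affine-injective : (c d : Vector ℤ (suc k)) (σ τ : Permutation (suc k) (suc k)) →
                   affine c σ ≗ affine d τ → c ≗ d × σ Perm.≈ τ
affine-injective c d σ τ eq =
  (λ i → +-cancelˡ 0ℤ _ _ (proj₁ (entries i))) , (λ i → proj₂ (entries i))
  where
  entries : ∀ i → 0ℤ + c i ≡ 0ℤ + d i × σ ⟨$⟩ʳ i ≡ τ ⟨$⟩ʳ i
  entries i = value-injective (0ℤ + c i) (0ℤ + d i)
    (trans (sym (affine-value c σ 0ℤ i)) (trans (eq (value 0ℤ i)) (affine-value d τ 0ℤ i)))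

-- Quotients and residues of a given affine permutation

periodic-* : ∀ {n} (f : ℤ → ℤ) → (∀ z → f (z + n) ≡ f z + n) → ∀ q z → f (z + q * n) ≡ f z + q * n
periodic-* {n} f periodic = λ { (+ m) z → forward m z ; (-[1+ m ]) z → backward (suc m) z }
  where
  open ≡-Reasoning
  forward : ∀ m z → f (z + + m * n) ≡ f z + + m * n
  forward zero    z = trans (cong f (+-identityʳ z)) (sym (+-identityʳ (f z)))
  forward (suc m) z = begin
    f (z + + suc m * n)         ≡⟨ cong f (step z (+ m) n) ⟩
    f (z + + m * n + n)         ≡⟨ periodic (z + + m * n) ⟩
    f (z + + m * n) + n         ≡⟨ cong (_+ n) (forward m z) ⟩
    f z + + m * n + n           ≡⟨ step (f z) (+ m) n ⟨
    f z + + suc m * n           ∎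
    where
    step : ∀ z m n → z + (1ℤ + m) * n ≡ z + m * n + n
    step = solve-∀
  backward : ∀ m z → f (z + - + m * n) ≡ f z + - + m * n
  -- A negative translation is undone by the forward case at the translated point `z′`.
  backward m z = begin
    f z′                             ≡⟨ undo (f z′) (+ m) n ⟩
    f z′ + + m * n + - + m * n       ≡⟨ cong (_+ - + m * n) (forward m z′) ⟨
    f (z′ + + m * n) + - + m * n     ≡⟨ cong (λ y → f y + - + m * n) (redo z (+ m) n) ⟩
    f z + - + m * n                  ∎
    where
    z′ = z + - + m * n
    undo : ∀ a m n → a ≡ a + m * n + - m * n
    undo = solve-∀
    redo : ∀ a m n → a + - m * n + m * n ≡ a
    redo = solve-∀

module Window (x : AffinePermutation k) where
  open AffinePermutation x
  open ≡-Reasoning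

  shifts : Vector ℤ (suc k)
  shifts i = quotient k (perm (value 0ℤ i))

  residues : Fin (suc k) → Fin (suc k)
  residues i = residue k (perm (value 0ℤ i))

  perm-value : ∀ q r → perm (value q r) ≡ value (q + shifts r) (residues r)
  perm-value q r = begin
    perm (value q r)
      ≡⟨ cong (λ p → perm (value p r)) (+-identityʳ q) ⟨
    perm (value (q + 0ℤ) r)                        ≡⟨ cong perm (value-shift q 0ℤ r) ⟩
    perm (value 0ℤ r + q * + suc k)                ≡⟨ periodic-* perm periodic q (value 0ℤ r) ⟩
    perm (value 0ℤ r) + q * + suc k
      ≡⟨ cong (_+ q * + suc k) (value-quotient-residue (perm (value 0ℤ r))) ⟨
    value (shifts r) (residues r) + q * + suc k    ≡⟨ value-shift q (shifts r) (residues r) ⟨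
    value (q + shifts r) (residues r)              ∎

  -- Starting in block `- shifts r` puts the image in block 0. Equal residues then give equal
  -- images, and injectivity of `perm` applies.
  residues-injective : ∀ {r s} → residues r ≡ residues s → r ≡ s
  residues-injective {r} {s} eq =
    proj₂ (value-injective (- shifts r) (- shifts s) (proj₁ bijective (begin
    perm (value (- shifts r) r)                    ≡⟨ perm-value (- shifts r) r ⟩
    value (- shifts r + shifts r) (residues r)
      ≡⟨ cong₂ value (trans (+-inverseˡ (shifts r)) (sym (+-inverseˡ (shifts s)))) eq ⟩
    value (- shifts s + shifts s) (residues s)     ≡⟨ perm-value (- shifts s) s ⟨
    perm (value (- shifts s) s)                    ∎)))

  -- A preimage of `value 0ℤ s` under `perm` need not lie in the window, but only its residue
  -- matters.
  residues-surjective : ∀ s → ∃ λ r → residues r ≡ s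
  residues-surjective s with z , perm-z ← proj₂ bijective (value 0ℤ s) =
    residue k z , proj₂ (value-injective (quotient k z + shifts (residue k z)) 0ℤ (begin
      value (quotient k z + shifts (residue k z)) (residues (residue k z))
        ≡⟨ perm-value (quotient k z) (residue k z) ⟨
      perm (value (quotient k z) (residue k z))
        ≡⟨ perm-z (value-quotient-residue z) ⟩
      value 0ℤ s                                                           ∎))

  permutation : Permutation (suc k) (suc k)
  permutation = ⤖⇒↔ (mk⤖ (residues-injective , strictlySurjective⇒surjective residues-surjective))

  -- The binomial coefficient in `sum-values` equals the prescribed window sum, which leaves
  -- `sum shifts * + suc k ≡ 0ℤ`.
  sum-shifts : sum shifts ≡ 0ℤ
  sum-shifts = *-cancelʳ-≡ (sum shifts) 0ℤ (+ suc k) (+-cancelʳ (+ ((k ℕ.+ 2) C 2)) _ _ (begin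
    sum shifts * + suc k + + ((k ℕ.+ 2) C 2)             ≡⟨ sum-values shifts permutation ⟨
    sum {suc k} (λ i → value (shifts i) (residues i))
      ≡⟨ sum-cong-≗ {suc k} (λ i → value-quotient-residue {k} (perm (value 0ℤ i))) ⟩
    sum {suc k} (λ i → perm (value 0ℤ i))                ≡⟨ windowSum ⟩
    + ((k ℕ.+ 2) C 2)                                    ∎))

  -- The first shift may be dropped and restored, since `sum-shifts` makes it the negated sum of the
  -- others.
  affine-window : affine (prependNegatedSum (tail shifts)) permutation ≗ perm
  affine-window = ≗-on-values λ q r → begin
    affine c⁺ permutation (value q r)         ≡⟨ affine-value c⁺ permutation q r ⟩
    value (q + c⁺ r) (residues r)
      ≡⟨ cong (λ c → value (q + c) (residues r)) (prependNegatedSum-tail shifts sum-shifts r) ⟩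
    value (q + shifts r) (residues r)         ≡⟨ perm-value q r ⟨
    perm (value q r)                          ∎
    where c⁺ = prependNegatedSum (tail shifts)

-- Assembling the bijections

vectors×permutations⤖affinePermutations : ∀ k →
  Bijection ((Fin k →-setoid ℤ) ×ₛ Permutations (suc k)) (AffinePermutations k)
vectors×permutations⤖affinePermutations k = record
  { to        = λ (c , σ) → toAffine c σ
  ; cong      = λ { {c , σ} {d , τ} → congruent c d σ τ }
  ; bijective = (λ { {c , σ} {d , τ} eq →
                     let c≗d , σ≈τ = affine-injective (prependNegatedSum c) (prependNegatedSum d) σ τ eq
                     -- Composing with `suc` discards the prepended entry and leaves the `k` free
                     -- quotients.
                     in c≗d ∘ suc , σ≈τ })
              , λ x → let open Window x in
                  (tail shifts , permutation) , λ { {c , σ} (c≗ , σ≈) z →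
                    trans (congruent c (tail shifts) σ permutation (c≗ , σ≈) z) (affine-window z) }
  }
  where
  congruent : ∀ c d σ τ → c ≗ d × σ Perm.≈ τ →
              affine (prependNegatedSum c) σ ≗ affine (prependNegatedSum d) τ
  congruent c d σ τ (c≗d , σ≈τ) =
    affine-cong (prependNegatedSum c) (prependNegatedSum d) σ τ (prependNegatedSum-cong c≗d) σ≈τ

theorem38 : (k : ℕ) → 1 ℕ.≤ k → Bijection (KCodes k) (AffinePermutations k)
theorem38 k _ =
  Compose.bijection (codes⤖differences k)
    (Compose.bijection (vectors⤖vectors×permutations k) (vectors×permutations⤖affinePermutations k))
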